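{- For every positive integer $n$, $$\sum_{k=0}^{n-1}\frac{q^{ -k(k-1)/2}}{\genfrac{[}{]}{0pt}{}{n}{k}_q}=\frac{(q^2;q)_n}{(q^2;q^2)_n}\sum_{i=0}^{n-1}\frac{C(i)\,(q^2;q^2)_i}{(q^2;q)_i\,(q^{i+2}-1)},$$ where $$C(i)=\frac{q^{i+1}+q^{3(i+1)}+q^{ -i(i-1)/2}+q^{ -(i+1)(i-4)/2}-q^{(2+3i-i^2)/2}-q^{ -(i+1)(i-2)/2}-2q^{2(i+1)}}{q^{i+1}-1}.$$ (The identity is an identity of rational functions in the indeterminate $q$.)
   Context: For an indeterminate $q$ and any $a$, $(a;q)_n=(1-a)(1-aq)\cdots(1-aq^{n-1})$, with $(a;q)_0=1$. The $q$-binomial coefficient is $\genfrac{[}{]}{0pt}{}{n}{k}_q=\frac{(q;q)_n}{(q;q)_k\,(q;q)_{n-k}}$ for $0\le k\le n$. -}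

module Defs where

open import Algebra.Bundles.Raw using (RawRing)
import Algebra.Definitions.RawSemiring as RawSemiringDefinitions
open import Data.Empty using (⊥-elim-irr)
open import Data.Fin.Base using (Fin; zero; suc; toℕ)
open import Data.Integer.Base as ℤ using (ℤ; +_; -[1+_])
open import Data.List.Base using (List; []; _∷_; map)
open import Data.Nat.Base as ℕ using (ℕ; zero; suc)
open import Data.Rational.Base as ℚ using (ℚ; 0ℚ; 1ℚ)
import Data.Rational.Properties as ℚ
open import Data.Sum.Base as Sum using (_⊎_; inj₁; inj₂; [_,_]′)
open import Level using (0ℓ)
open import Relation.Binary.PropositionalEquality
open import Relation.Nullary using (¬_; yes; no)

-- Coefficients in order of increasing degree; trailing zeros are allowed,
-- so polynomials are compared with _≈ₚ_ rather than _≡_.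
ℚ[q] : Set
ℚ[q] = List ℚ

coeff : ℚ[q] → ℕ → ℚ
coeff []      _       = 0ℚ
coeff (a ∷ p) zero    = a
coeff (a ∷ p) (suc i) = coeff p i

infix 4 _≈ₚ_ _≉ₚ_

record _≈ₚ_ (p r : ℚ[q]) : Set where
  constructor pointwise
  field
    at : ∀ i → coeff p i ≡ coeff r i

open _≈ₚ_ public

_≉ₚ_ : ℚ[q] → ℚ[q] → Set
p ≉ₚ r = ¬ (p ≈ₚ r)

infixl 6 _+ₚ_
infixl 7 _*ₚ_ _·ₚ_
infix  8 -ₚ_

0ₚ 1ₚ qₚ : ℚ[q]
0ₚ = []
1ₚ = 1ℚ ∷ []
qₚ = 0ℚ ∷ 1ℚ ∷ []

_+ₚ_ : ℚ[q] → ℚ[q] → ℚ[q]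
[]      +ₚ r       = r
(a ∷ p) +ₚ []      = a ∷ p
(a ∷ p) +ₚ (b ∷ r) = a ℚ.+ b ∷ p +ₚ r

-ₚ_ : ℚ[q] → ℚ[q]
-ₚ p = map (λ a → ℚ.- a) p

_·ₚ_ : ℚ → ℚ[q] → ℚ[q]
a ·ₚ r = map (a ℚ.*_) r

_*ₚ_ : ℚ[q] → ℚ[q] → ℚ[q]
[]      *ₚ r = []
(a ∷ p) *ₚ r = (a ·ₚ r) +ₚ (0ℚ ∷ p *ₚ r)

coeff-+ : ∀ p r i → coeff (p +ₚ r) i ≡ coeff p i ℚ.+ coeff r i
coeff-+ []      r       i       = sym (ℚ.+-identityˡ _)
coeff-+ (a ∷ p) []      i       = sym (ℚ.+-identityʳ _)
coeff-+ (a ∷ p) (b ∷ r) zero    = refl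
coeff-+ (a ∷ p) (b ∷ r) (suc i) = coeff-+ p r i

coeff-neg : ∀ p i → coeff (-ₚ p) i ≡ ℚ.- coeff p i
coeff-neg []      i       = refl
coeff-neg (a ∷ p) zero    = refl
coeff-neg (a ∷ p) (suc i) = coeff-neg p i

coeff-· : ∀ a r i → coeff (a ·ₚ r) i ≡ a ℚ.* coeff r i
coeff-· a []      i       = sym (ℚ.*-zeroʳ a)
coeff-· a (b ∷ r) zero    = refl
coeff-· a (b ∷ r) (suc i) = coeff-· a r i

coeff-*-step : ∀ a p r i →
  coeff ((a ∷ p) *ₚ r) i ≡ a ℚ.* coeff r i ℚ.+ coeff (0ℚ ∷ p *ₚ r) i
coeff-*-step a p r i =
  trans (coeff-+ (a ·ₚ r) (0ℚ ∷ p *ₚ r) i) (cong (ℚ._+ _) (coeff-· a r i))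

coeff-*-zero : ∀ p r → coeff (p *ₚ r) 0 ≡ coeff p 0 ℚ.* coeff r 0
coeff-*-zero []      r = sym (ℚ.*-zeroˡ (coeff r 0))
coeff-*-zero (a ∷ p) r = trans (coeff-*-step a p r 0) (ℚ.+-identityʳ _)

∷-≈0 : ∀ {a p} → a ≡ 0ℚ → p ≈ₚ 0ₚ → a ∷ p ≈ₚ 0ₚ
∷-≈0 a≡0 p≈0 .at zero    = a≡0
∷-≈0 a≡0 p≈0 .at (suc i) = p≈0 .at i

tail-≈0 : ∀ {a p} → a ∷ p ≈ₚ 0ₚ → p ≈ₚ 0ₚ
tail-≈0 p≈0 .at i = p≈0 .at (suc i)

≈ₚ-trans : ∀ {p r s} → p ≈ₚ r → r ≈ₚ s → p ≈ₚ s
≈ₚ-trans p≈r r≈s .at i = trans (p≈r .at i) (r≈s .at i)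

≈ₚ-sym : ∀ {p r} → p ≈ₚ r → r ≈ₚ p
≈ₚ-sym p≈r .at i = sym (p≈r .at i)

*ₚ-zeroˡ : ∀ p r → p ≈ₚ 0ₚ → p *ₚ r ≈ₚ 0ₚ
*ₚ-zeroˡ []      r p≈0 .at i = refl
*ₚ-zeroˡ (a ∷ p) r p≈0 .at i = trans (coeff-*-step a p r i) (cong₂ ℚ._+_
  (trans (cong (ℚ._* coeff r i) (p≈0 .at 0)) (ℚ.*-zeroˡ (coeff r i)))
  (∷-≈0 refl (*ₚ-zeroˡ p r (tail-≈0 p≈0)) .at i))

0∷-*ₚ : ∀ {a} → a ≡ 0ℚ → ∀ p r → (a ∷ p) *ₚ r ≈ₚ 0ℚ ∷ p *ₚ r
0∷-*ₚ refl p r .at i = trans (coeff-*-step 0ℚ p r i)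
  (trans (cong (ℚ._+ coeff (0ℚ ∷ p *ₚ r) i) (ℚ.*-zeroˡ (coeff r i))) (ℚ.+-identityˡ _))

*ₚ-0∷ : ∀ {b} → b ≡ 0ℚ → ∀ p r → p *ₚ (b ∷ r) ≈ₚ 0ℚ ∷ p *ₚ r
*ₚ-0∷ b≡0  []      r .at zero    = refl
*ₚ-0∷ b≡0  []      r .at (suc i) = refl
*ₚ-0∷ refl (a ∷ p) r .at zero    = trans (coeff-*-zero (a ∷ p) (0ℚ ∷ r)) (ℚ.*-zeroʳ a)
*ₚ-0∷ {b} b≡0 (a ∷ p) r .at (suc i) = trans (coeff-*-step a p (b ∷ r) (suc i))
  (trans (cong (λ c → a ℚ.* coeff r i ℚ.+ c) (*ₚ-0∷ b≡0 p r .at i)) (sym (coeff-*-step a p r i)))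

p*q≡0⇒p≡0∨q≡0 : ∀ a b → a ℚ.* b ≡ 0ℚ → a ≡ 0ℚ ⊎ b ≡ 0ℚ
p*q≡0⇒p≡0∨q≡0 a b ab≡0 with a ℚ.≟ 0ℚ
... | yes a≡0 = inj₁ a≡0
... | no  a≢0 = inj₂ (begin
  b                        ≡⟨ ℚ.*-identityˡ b ⟨
  1ℚ ℚ.* b                 ≡⟨ cong (ℚ._* b) (ℚ.*-inverseˡ a) ⟨
  (ℚ.1/ a ℚ.* a) ℚ.* b     ≡⟨ ℚ.*-assoc (ℚ.1/ a) a b ⟩
  ℚ.1/ a ℚ.* (a ℚ.* b)     ≡⟨ cong (ℚ.1/ a ℚ.*_) ab≡0 ⟩
  ℚ.1/ a ℚ.* 0ℚ            ≡⟨ ℚ.*-zeroʳ (ℚ.1/ a) ⟩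
  0ℚ                       ∎)
  where
  open ≡-Reasoning
  instance
    _ : ℚ.NonZero a
    _ = ℚ.≢-nonZero a≢0

*ₚ-domain : ∀ p r → p *ₚ r ≈ₚ 0ₚ → p ≈ₚ 0ₚ ⊎ r ≈ₚ 0ₚ
*ₚ-domain []      r       pr≈0 = inj₁ (pointwise λ _ → refl)
*ₚ-domain (a ∷ p) []      pr≈0 = inj₂ (pointwise λ _ → refl)
*ₚ-domain (a ∷ p) (b ∷ r) pr≈0 =
  [ (λ a≡0 → Sum.map₁ (∷-≈0 a≡0)
      (*ₚ-domain p (b ∷ r) (tail-≈0 (≈ₚ-trans (≈ₚ-sym (0∷-*ₚ a≡0 p (b ∷ r))) pr≈0))))
  , (λ b≡0 → Sum.map₂ (∷-≈0 b≡0)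
      (*ₚ-domain (a ∷ p) r (tail-≈0 (≈ₚ-trans (≈ₚ-sym (*ₚ-0∷ b≡0 (a ∷ p) r)) pr≈0))))
  ]′ (p*q≡0⇒p≡0∨q≡0 a b (trans (sym (coeff-*-zero (a ∷ p) (b ∷ r))) (pr≈0 .at 0)))

*ₚ-≉0 : ∀ {p r} → p ≉ₚ 0ₚ → r ≉ₚ 0ₚ → p *ₚ r ≉ₚ 0ₚ
*ₚ-≉0 {p} {r} p≉0 r≉0 pr≈0 = [ p≉0 , r≉0 ]′ (*ₚ-domain p r pr≈0)

1ₚ≉0 : 1ₚ ≉ₚ 0ₚ
1ₚ≉0 1≈0 = ℚ.1≢0 (1≈0 .at 0)

record ℚ⟨q⟩ : Set where
  no-eta-equality
  constructor mk
  field
    num   : ℚ[q]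
    den   : ℚ[q]
    den≉0 : den ≉ₚ 0ₚ

open ℚ⟨q⟩ public

infix 4 _≈_ _≉_

record _≈_ (x y : ℚ⟨q⟩) : Set where
  constructor cross
  field
    cross-eq : num x *ₚ den y ≈ₚ num y *ₚ den x

open _≈_ public

_≉_ : ℚ⟨q⟩ → ℚ⟨q⟩ → Set
x ≉ y = ¬ (x ≈ y)

infixl 6 _+_ _-_
infixl 7 _*_ _÷_
infix  8 -_

fromPoly : ℚ[q] → ℚ⟨q⟩
num   (fromPoly p) = p
den   (fromPoly p) = 1ₚ
den≉0 (fromPoly p) = 1ₚ≉0

0# 1# q : ℚ⟨q⟩
0# = fromPoly 0ₚ
1# = fromPoly 1ₚ
q  = fromPoly qₚ

_+_ _*_ : ℚ⟨q⟩ → ℚ⟨q⟩ → ℚ⟨q⟩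

num   (x + y) = num x *ₚ den y +ₚ num y *ₚ den x
den   (x + y) = den x *ₚ den y
den≉0 (x + y) = *ₚ-≉0 (den≉0 x) (den≉0 y)

num   (x * y) = num x *ₚ num y
den   (x * y) = den x *ₚ den y
den≉0 (x * y) = *ₚ-≉0 (den≉0 x) (den≉0 y)

-_ : ℚ⟨q⟩ → ℚ⟨q⟩
num   (- x) = -ₚ num x
den   (- x) = den x
den≉0 (- x) = den≉0 x

_-_ : ℚ⟨q⟩ → ℚ⟨q⟩ → ℚ⟨q⟩
x - y = x + (- y)

record NonZero (x : ℚ⟨q⟩) : Set where
  field
    nonZero : x ≉ 0#

num≉0 : ∀ x → NonZero x → num x ≉ₚ 0ₚ
num≉0 x x≉0 n≈0 = NonZero.nonZero x≉0 (cross (*ₚ-zeroˡ (num x) 1ₚ n≈0))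

≉0-num : ∀ {x} → num x ≉ₚ 0ₚ → NonZero x
≉0-num {x} n≉0 .NonZero.nonZero (cross eq) = *ₚ-≉0 n≉0 1ₚ≉0 eq

_÷_ : (x y : ℚ⟨q⟩) .{{_ : NonZero y}} → ℚ⟨q⟩
num   (x ÷ y) = num x *ₚ den y
den   (x ÷ y) = den x *ₚ num y
den≉0 (_÷_ x y {{y≉0}}) d≈0 = ⊥-elim-irr (*ₚ-≉0 (den≉0 x) (num≉0 y y≉0) d≈0)

rawRing : RawRing 0ℓ 0ℓ
rawRing = record
  { Carrier = ℚ⟨q⟩ ; _≈_ = _≈_ ; _+_ = _+_ ; _*_ = _*_ ; -_ = -_ ; 0# = 0# ; 1# = 1# }

open RawSemiringDefinitions (RawRing.rawSemiring rawRing) public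
  using (_×_; _^_; sum; product)

*-nonZero : ∀ {x y} → NonZero x → NonZero y → NonZero (x * y)
*-nonZero {x} {y} x≉0 y≉0 = ≉0-num (*ₚ-≉0 (num≉0 x x≉0) (num≉0 y y≉0))

÷-nonZero : ∀ {x y} → NonZero x → (y≉0 : NonZero y) → NonZero (_÷_ x y {{y≉0}})
÷-nonZero {x} {y} x≉0 _ = ≉0-num (*ₚ-≉0 (num≉0 x x≉0) (den≉0 y))

1-nonZero : NonZero 1#
1-nonZero = ≉0-num 1ₚ≉0

^-nonZero : ∀ {x} → NonZero x → ∀ n → NonZero (x ^ n)
^-nonZero x≉0 zero    = 1-nonZero
^-nonZero x≉0 (suc n) = *-nonZero x≉0 (^-nonZero x≉0 n)

instance
  q-nonZero : NonZero q
  q-nonZero = ≉0-num (λ eq → ℚ.1≢0 (eq .at 1))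

-- A sufficient condition for x to be regular at q = 0 with value v.
record At0 (x : ℚ⟨q⟩) (v : ℚ) : Set where
  constructor _,_
  field
    num₀ : coeff (num x) 0 ≡ v
    den₀ : coeff (den x) 0 ≡ 1ℚ

at0-nonZero : ∀ {x v} → v ≢ 0ℚ → At0 x v → NonZero x
at0-nonZero v≢0 (n , _) = ≉0-num λ eq → v≢0 (trans (sym n) (eq .at 0))

at0-* : ∀ {x y v w} → At0 x v → At0 y w → At0 (x * y) (v ℚ.* w)
at0-* {x} {y} (n , d) (n′ , d′) =
  trans (coeff-*-zero (num x) (num y)) (cong₂ ℚ._*_ n n′) ,
  trans (coeff-*-zero (den x) (den y)) (cong₂ ℚ._*_ d d′)

at0-+ : ∀ {x y v w} → At0 x v → At0 y w → At0 (x + y) (v ℚ.+ w)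
at0-+ {x} {y} {v} {w} (n , d) (n′ , d′) =
  trans (coeff-+ (num x *ₚ den y) (num y *ₚ den x) 0) (cong₂ ℚ._+_
    (trans (coeff-*-zero (num x) (den y)) (trans (cong₂ ℚ._*_ n d′) (ℚ.*-identityʳ v)))
    (trans (coeff-*-zero (num y) (den x)) (trans (cong₂ ℚ._*_ n′ d) (ℚ.*-identityʳ w)))) ,
  trans (coeff-*-zero (den x) (den y)) (cong₂ ℚ._*_ d d′)

at0-neg : ∀ {x v} → At0 x v → At0 (- x) (ℚ.- v)
at0-neg {x} (n , d) = trans (coeff-neg (num x) 0) (cong (λ a → ℚ.- a) n) , d

at0-1 : At0 1# 1ℚ
at0-1 = refl , refl

at0-q : At0 q 0ℚ
at0-q = refl , refl

at0-*-vanishes : ∀ {x y v} → At0 x 0ℚ → At0 y v → At0 (x * y) 0ℚ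
at0-*-vanishes {v = v} x₀ y₀ = subst (At0 _) (ℚ.*-zeroˡ v) (at0-* x₀ y₀)

at0-^ : ∀ {x} → At0 x 0ℚ → ∀ n → At0 (x ^ suc n) 0ℚ
at0-^ x₀ zero    = at0-*-vanishes x₀ at0-1
at0-^ x₀ (suc n) = at0-*-vanishes x₀ (at0-^ x₀ n)

infixr 8 _^ᶻ_

_^ᶻ_ : (x : ℚ⟨q⟩) (e : ℤ) .{{_ : NonZero x}} → ℚ⟨q⟩
x ^ᶻ (+ n) = x ^ n
_^ᶻ_ x -[1+ n ] {{x≉0}} = _÷_ 1# (x ^ suc n) {{^-nonZero x≉0 (suc n)}}

∑< : ℕ → (ℕ → ℚ⟨q⟩) → ℚ⟨q⟩
∑< n f = sum {n} (λ k → f (toℕ k))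

infixr 5 ∑<
syntax ∑< n (λ k → e) = ∑[ k < n ] e

-- ⟨ a ⨾ b ⟩ n  is the q-Pochhammer symbol (a ; b)ₙ to base b.
infix 9 ⟨_⨾_⟩_

⟨_⨾_⟩_ : ℚ⟨q⟩ → ℚ⟨q⟩ → ℕ → ℚ⟨q⟩
⟨ a ⨾ b ⟩ n = product {n} (λ j → 1# - a * b ^ toℕ j)

product-at0 : ∀ {n} (f : Fin n → ℚ⟨q⟩) → (∀ j → At0 (f j) 1ℚ) → At0 (product f) 1ℚ
product-at0 {zero}  f f₀ = at0-1
product-at0 {suc n} f f₀ = at0-* {f zero} (f₀ zero) (product-at0 (λ j → f (suc j)) λ j → f₀ (suc j))

⨾-nonZero : ∀ {a b} → At0 a 0ℚ → At0 b 0ℚ → ∀ n → NonZero (⟨ a ⨾ b ⟩ n)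
⨾-nonZero {a} {b} a₀ b₀ n =
  at0-nonZero ℚ.1≢0 (product-at0 _ λ (j : Fin n) → at0-+ at0-1 (at0-neg (a*b^ (toℕ j))))
  where
  a*b^ : ∀ j → At0 (a * b ^ j) 0ℚ
  a*b^ zero    = at0-*-vanishes a₀ at0-1
  a*b^ (suc j) = at0-*-vanishes a₀ (at0-^ b₀ j)

⟨q⨾q⟩-nonZero : ∀ n → NonZero (⟨ q ⨾ q ⟩ n)
⟨q⨾q⟩-nonZero = ⨾-nonZero at0-q at0-q

⟨q²⨾q⟩-nonZero : ∀ n → NonZero (⟨ q ^ 2 ⨾ q ⟩ n)
⟨q²⨾q⟩-nonZero = ⨾-nonZero (at0-^ at0-q 1) at0-q

⟨q²⨾q²⟩-nonZero : ∀ n → NonZero (⟨ q ^ 2 ⨾ q ^ 2 ⟩ n)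
⟨q²⨾q²⟩-nonZero = ⨾-nonZero (at0-^ at0-q 1) (at0-^ at0-q 1)

q^[1+n]-1-nonZero : ∀ n → NonZero (q ^ suc n - 1#)
q^[1+n]-1-nonZero n = at0-nonZero (λ ()) (at0-+ (at0-^ at0-q n) (at0-neg at0-1))

-- The q-binomial coefficient; only meaningful for k ≤ n.
qbinom : ℕ → ℕ → ℚ⟨q⟩
qbinom n k = (⟨ q ⨾ q ⟩ n ÷ (⟨ q ⨾ q ⟩ k * ⟨ q ⨾ q ⟩ (n ℕ.∸ k)))
  {{*-nonZero (⟨q⨾q⟩-nonZero k) (⟨q⨾q⟩-nonZero (n ℕ.∸ k))}}

qbinom-nonZero : ∀ n k → NonZero (qbinom n k)
qbinom-nonZero n k = ÷-nonZero (⟨q⨾q⟩-nonZero n)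
  (*-nonZero (⟨q⨾q⟩-nonZero k) (⟨q⨾q⟩-nonZero (n ℕ.∸ k)))

-- Every numerator halved below is even, so the integer division is exact.
C : ℕ → ℚ⟨q⟩
C i = ((
    q ^ᶻ (I ℤ.+ + 1)
  + q ^ᶻ (+ 3 ℤ.* (I ℤ.+ + 1))
  + q ^ᶻ (ℤ.- (I ℤ.* (I ℤ.- + 1)) ℤ./ + 2)
  + q ^ᶻ (ℤ.- ((I ℤ.+ + 1) ℤ.* (I ℤ.- + 4)) ℤ./ + 2)
  - q ^ᶻ ((+ 2 ℤ.+ + 3 ℤ.* I ℤ.- I ℤ.* I) ℤ./ + 2)
  - q ^ᶻ (ℤ.- ((I ℤ.+ + 1) ℤ.* (I ℤ.- + 2)) ℤ./ + 2)
  - 2 × q ^ᶻ (+ 2 ℤ.* (I ℤ.+ + 1))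
  ) ÷ (q ^ suc i - 1#)) {{q^[1+n]-1-nonZero i}}
  where
  I : ℤ
  I = + i

{-# OPTIONS --safe #-}
module Submission where

-- Put t(n,k) = q^(-k(k-1)/2) / [n,k]. Comparing q-binomial coefficients gives
--   (1 - q^(n+1)) t(n+1,k)         = (1 - q^(n+1-k)) t(n,k),
--   (1 - q^(n+1)) q^k t(n+1,k+1)   = (1 - q^(k+1)) t(n,k),
-- and therefore
--   (1 - q^(n+1)) (t(n+1,k) + q^(n+1) t(n+1,k+1)) = (1 - q^(n+2)) t(n,k).
-- Summed over k < n, this turns into a recurrence for S(n) = Σ t(n,k),
--   (1 - q^(2n+2)) S(n+1) = (1 - q^(n+2)) S(n) - C(n),
-- because the boundary terms t(n+1,n) and t(n+1,0), which the shifted sums miss, combine to -C(n).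
-- The ratio (q²;q)_n / (q²;q²)_n solves the homogeneous recurrence, so the right-hand side
-- is what variation of constants produces.

open import Algebra.Bundles using (AbelianGroup; CommutativeRing; CommutativeSemiring; Monoid; Ring)
import Algebra.Consequences.Setoid as Consequences
import Algebra.Construct.Pointwise as Pointwise
open import Algebra.Definitions using (AlmostRightCancellative)
import Algebra.Morphism.GroupMonomorphism as GroupMonomorphism
open import Algebra.Morphism.Structures using (IsGroupMonomorphism)
import Algebra.Properties.CommutativeSemigroup as CommutativeSemigroupProperties
import Algebra.Properties.Monoid.Mult as MonoidMult
import Algebra.Properties.Monoid.Sum as MonoidSum
import Algebra.Properties.Ring as RingProperties
import Algebra.Properties.Semiring.Exp as Exp
import Algebra.Properties.Semiring.Sum as SemiringSum
import Algebra.Solver.Ring as RingSolver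
open import Algebra.Solver.Ring.AlmostCommutativeRing
  using (fromCommutativeRing; _-Raw-AlmostCommutative⟶_)
import Algebra.Solver.Ring.NaturalCoefficients.Default as SemiringSolver
open import Data.Empty using (⊥-elim-irr)
open import Data.Fin.Base using (toℕ)
import Data.Fin.Properties as Fin
open import Data.Integer.Base as ℤ using (ℤ; +_; -[1+_])
open import Data.Integer.DivMod using (div-pos-is-/ℕ; [n/ℕd]*d≤n; n<s[n/ℕd]*d)
import Data.Integer.Properties as ℤ
open import Data.Integer.Solver renaming (module +-*-Solver to ℤ-Solver)
open import Data.List.Base using ([]; _∷_)
open import Data.Maybe.Base as Maybe using (Maybe)
open import Data.Nat.Base as ℕ using (ℕ; zero; suc)
import Data.Nat.Properties as ℕ
open import Data.Product.Base using (_,_)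
open import Data.Rational.Base as ℚ using (ℚ; 0ℚ; 1ℚ)
import Data.Rational.Properties as ℚ
open import Data.Sum.Base using (_⊎_; [_,_]′)
open import Function.Base using (_∘_; _⟨_⟩_)
open import Level using (0ℓ)
open import Relation.Binary.Bundles using (Setoid)
open import Relation.Binary.Consequences using (dec⇒weaklyDec)
open import Relation.Binary.PropositionalEquality as ≡ using (_≡_; cong)
import Relation.Binary.Reasoning.Setoid as SetoidReasoning
open import Relation.Nullary using (contradiction)

-- Sums, recurrences and divisions in general

module _ {c ℓ} (M : Monoid c ℓ) where
  open Monoid M
  open MonoidSum M using (sum; sum-cong-≋; sum-init-last)

  sum-toℕ-last : ∀ (f : ℕ → Carrier) n → sum {suc n} (f ∘ toℕ) ≈ sum {n} (f ∘ toℕ) ∙ f n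
  sum-toℕ-last f n = trans (sum-init-last {n} (f ∘ toℕ)) (∙-cong
    (sum-cong-≋ {n} λ k → reflexive (cong f (Fin.toℕ-inject₁ k)))
    (reflexive (cong f (Fin.toℕ-fromℕ n))))

module _ {c ℓ} (R : CommutativeSemiring c ℓ) where
  open CommutativeSemiring R
  open SemiringSum semiring using (sum)
  open SetoidReasoning setoid

  -- Substituting u = v z turns the recurrence for u into z (suc n) ≈ z n + w n.
  variationOfConstants : ∀ {a b c u v w : ℕ → Carrier} →
    (∀ n {x y} → a n * x ≈ a n * y → x ≈ y) →
    (∀ n → a n * v (suc n) ≈ b n * v n) →
    u 0 ≈ 0# → (∀ n → a n * u (suc n) ≈ b n * u n + c n) →
    (∀ n → b n * (v n * w n) ≈ c n) →
    ∀ n → u n ≈ v n * sum {n} (w ∘ toℕ)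
  variationOfConstants {v = v} cancel v-suc u₀ u-suc bvw≈c zero = trans u₀ (sym (zeroʳ (v 0)))
  variationOfConstants {a} {b} {c} {u} {v} {w} cancel v-suc u₀ u-suc bvw≈c (suc n) = cancel n (begin
    a n * u (suc n)                                 ≈⟨ u-suc n ⟩
    b n * u n + c n                                 ≈⟨ +-cong (*-congˡ u≈v*Σw) (sym (bvw≈c n)) ⟩
    b n * (v n * Σw) + b n * (v n * w n)            ≈⟨ distribˡ (b n) (v n * Σw) (v n * w n) ⟨
    b n * (v n * Σw + v n * w n)                    ≈⟨ *-congˡ (distribˡ (v n) Σw (w n)) ⟨
    b n * (v n * (Σw + w n))                        ≈⟨ *-assoc (b n) (v n) (Σw + w n) ⟨
    (b n * v n) * (Σw + w n)                        ≈⟨ *-cong (v-suc n) (sum-toℕ-last +-monoid w n) ⟨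
    (a n * v (suc n)) * sum {suc n} (w ∘ toℕ)       ≈⟨ *-assoc (a n) (v (suc n)) _ ⟩
    a n * (v (suc n) * sum {suc n} (w ∘ toℕ))       ∎)
    where
    Σw : Carrier
    Σw = sum {n} (w ∘ toℕ)
    u≈v*Σw : u n ≈ v n * Σw
    u≈v*Σw = variationOfConstants cancel v-suc u₀ u-suc bvw≈c n

module _ {c ℓ} (R : Ring c ℓ) where
  open Ring R
  open RingProperties R using (x∙y⁻¹≈ε⇒x≈y; x≈y⇒x∙y⁻¹≈ε; [y-z]x≈yx-zx)

  noZeroDivisors⇒almostCancelʳ : (∀ x y → x * y ≈ 0# → x ≈ 0# ⊎ y ≈ 0#) →
    AlmostRightCancellative _≈_ 0# _*_
  noZeroDivisors⇒almostCancelʳ xy≈0⇒x≈0∨y≈0 x y z x≉0 yx≈zx =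
    [ x∙y⁻¹≈ε⇒x≈y y z , (λ x≈0 → contradiction x≈0 x≉0) ]′
    (xy≈0⇒x≈0∨y≈0 (y - z) x (trans ([y-z]x≈yx-zx x y z) (x≈y⇒x∙y⁻¹≈ε yx≈zx)))

j*d≤i<[1+j]*d⇒i/d≡j : ∀ i j d .{{_ : ℕ.NonZero d}} →
  j ℤ.* + d ℤ.≤ i → i ℤ.< ℤ.suc j ℤ.* + d → i ℤ./ + d ≡ j
j*d≤i<[1+j]*d⇒i/d≡j i j d j*d≤i i<[1+j]*d = ≡.trans (div-pos-is-/ℕ i d) (ℤ.≤-antisym
  (k*d<[1+l]*d⇒k≤l (ℤ.≤-<-trans ([n/ℕd]*d≤n i d) i<[1+j]*d))
  (k*d<[1+l]*d⇒k≤l (ℤ.≤-<-trans j*d≤i (n<s[n/ℕd]*d i d))))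
  where
  k*d<[1+l]*d⇒k≤l : ∀ {k l} → k ℤ.* + d ℤ.< ℤ.suc l ℤ.* + d → k ℤ.≤ l
  k*d<[1+l]*d⇒k≤l {k} {l} k*d<[1+l]*d = ≡.subst (k ℤ.≤_) (ℤ.pred-suc l)
    (ℤ.i<j⇒i≤pred[j] (ℤ.*-cancelʳ-<-nonNeg {k} {ℤ.suc l} (+ d) k*d<[1+l]*d))

[i*d+j]/d≡i+j/d : ∀ i j d .{{_ : ℕ.NonZero d}} → (i ℤ.* + d ℤ.+ j) ℤ./ + d ≡ i ℤ.+ j ℤ./ + d
[i*d+j]/d≡i+j/d i j d = ≡.trans
  (j*d≤i<[1+j]*d⇒i/d≡j (i ℤ.* + d ℤ.+ j) (i ℤ.+ k) d
    (begin
      (i ℤ.+ k) ℤ.* + d                ≡⟨ ℤ.*-distribʳ-+ (+ d) i k ⟩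
      i ℤ.* + d ℤ.+ k ℤ.* + d          ≤⟨ ℤ.+-monoʳ-≤ (i ℤ.* + d) ([n/ℕd]*d≤n j d) ⟩
      i ℤ.* + d ℤ.+ j                  ∎)
    (begin-strict
      i ℤ.* + d ℤ.+ j                  <⟨ ℤ.+-monoʳ-< (i ℤ.* + d) (n<s[n/ℕd]*d j d) ⟩
      i ℤ.* + d ℤ.+ ℤ.suc k ℤ.* + d    ≡⟨ solve 3 (λ i k d →
        i :* d :+ (con (+ 1) :+ k) :* d := (con (+ 1) :+ (i :+ k)) :* d) ≡.refl i k (+ d) ⟩
      ℤ.suc (i ℤ.+ k) ℤ.* + d          ∎))
  (cong (ℤ._+_ i) (≡.sym (div-pos-is-/ℕ j d)))
  where
  open ℤ.≤-Reasoning
  open ℤ-Solver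
  k : ℤ
  k = j ℤ./ℕ d

-- The ring of polynomials

open import Defs

private
  variable
    a b : ℚ
    p p′ r r′ : ℚ[q]

coefficientGroup : AbelianGroup 0ℓ 0ℓ
coefficientGroup = Pointwise.abelianGroup ℕ ℚ.+-0-abelianGroup

coeff-isGroupMonomorphism : IsGroupMonomorphism
  (record { Carrier = ℚ[q] ; _≈_ = _≈ₚ_ ; _∙_ = _+ₚ_ ; ε = 0ₚ ; _⁻¹ = -ₚ_ })
  (AbelianGroup.rawGroup coefficientGroup) coeff
coeff-isGroupMonomorphism = record
  { isGroupHomomorphism = record
    { isMonoidHomomorphism = record
      { isMagmaHomomorphism = record { isRelHomomorphism = record { cong = at } ; homo = coeff-+ }
      ; ε-homo = λ _ → ≡.refl
      }
    ; ⁻¹-homo = coeff-neg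
    }
  ; injective = pointwise
  }

+ₚ-0ₚ-abelianGroup : AbelianGroup 0ℓ 0ℓ
+ₚ-0ₚ-abelianGroup = record
  { isAbelianGroup = GroupMonomorphism.isAbelianGroup coeff-isGroupMonomorphism
      (AbelianGroup.isAbelianGroup coefficientGroup)
  }

open AbelianGroup +ₚ-0ₚ-abelianGroup using () renaming
  ( setoid to ≈ₚ-setoid ; refl to ≈ₚ-refl
  ; ∙-cong to +ₚ-cong ; ∙-congˡ to +ₚ-congˡ
  ; comm to +ₚ-comm ; identityʳ to +ₚ-identityʳ
  ; inverseʳ to -ₚ-inverseʳ ; ⁻¹-cong to -ₚ-cong
  )
open CommutativeSemigroupProperties (AbelianGroup.commutativeSemigroup +ₚ-0ₚ-abelianGroup) using ()
  renaming (interchange to +ₚ-interchange; x∙yz≈y∙xz to +ₚ-x∙yz≈y∙xz)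

∷-cong : a ≡ b → p ≈ₚ r → a ∷ p ≈ₚ b ∷ r
∷-cong a≡b p≈r .at zero    = a≡b
∷-cong a≡b p≈r .at (suc i) = p≈r .at i

·ₚ-congˡ : ∀ a → p ≈ₚ r → a ·ₚ p ≈ₚ a ·ₚ r
·ₚ-congˡ {p} {r} a p≈r .at i = begin
  coeff (a ·ₚ p) i    ≡⟨ coeff-· a p i ⟩
  a ℚ.* coeff p i     ≡⟨ cong (a ℚ.*_) (p≈r .at i) ⟩
  a ℚ.* coeff r i     ≡⟨ coeff-· a r i ⟨
  coeff (a ·ₚ r) i    ∎
  where open ≡.≡-Reasoning

·ₚ-distribˡ : ∀ a p r → a ·ₚ (p +ₚ r) ≈ₚ a ·ₚ p +ₚ a ·ₚ r
·ₚ-distribˡ a []      r       = ≈ₚ-refl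
·ₚ-distribˡ a (b ∷ p) []      = ≈ₚ-refl
·ₚ-distribˡ a (b ∷ p) (c ∷ r) = ∷-cong (ℚ.*-distribˡ-+ a b c) (·ₚ-distribˡ a p r)

·ₚ-distribʳ : ∀ a b p → (a ℚ.+ b) ·ₚ p ≈ₚ a ·ₚ p +ₚ b ·ₚ p
·ₚ-distribʳ a b []      = ≈ₚ-refl
·ₚ-distribʳ a b (c ∷ p) = ∷-cong (ℚ.*-distribʳ-+ c a b) (·ₚ-distribʳ a b p)

·ₚ-assoc : ∀ a b p → (a ℚ.* b) ·ₚ p ≈ₚ a ·ₚ (b ·ₚ p)
·ₚ-assoc a b []      = ≈ₚ-refl
·ₚ-assoc a b (c ∷ p) = ∷-cong (ℚ.*-assoc a b c) (·ₚ-assoc a b p)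

·ₚ-identity : ∀ p → 1ℚ ·ₚ p ≈ₚ p
·ₚ-identity []      = ≈ₚ-refl
·ₚ-identity (a ∷ p) = ∷-cong (ℚ.*-identityˡ a) (·ₚ-identity p)

module _ where
  open SetoidReasoning ≈ₚ-setoid

  *ₚ-zeroʳ : ∀ p → p *ₚ 0ₚ ≈ₚ 0ₚ
  *ₚ-zeroʳ []      = ≈ₚ-refl
  *ₚ-zeroʳ (a ∷ p) = ∷-≈0 ≡.refl (*ₚ-zeroʳ p)

  *ₚ-∷ : ∀ p b r → p *ₚ (b ∷ r) ≈ₚ b ·ₚ p +ₚ (0ℚ ∷ p *ₚ r)
  *ₚ-∷ []      b r = ≈ₚ-sym (∷-≈0 ≡.refl ≈ₚ-refl)
  *ₚ-∷ (a ∷ p) b r = ∷-cong (cong (ℚ._+ 0ℚ) (ℚ.*-comm a b)) (begin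
    a ·ₚ r +ₚ p *ₚ (b ∷ r)                 ≈⟨ +ₚ-congˡ {a ·ₚ r} (*ₚ-∷ p b r) ⟩
    a ·ₚ r +ₚ (b ·ₚ p +ₚ (0ℚ ∷ p *ₚ r))    ≈⟨ +ₚ-x∙yz≈y∙xz (a ·ₚ r) (b ·ₚ p) (0ℚ ∷ p *ₚ r) ⟩
    b ·ₚ p +ₚ (a ∷ p) *ₚ r                 ∎)

  *ₚ-comm : ∀ p r → p *ₚ r ≈ₚ r *ₚ p
  *ₚ-comm []      r = ≈ₚ-sym (*ₚ-zeroʳ r)
  *ₚ-comm (a ∷ p) r = begin
    a ·ₚ r +ₚ (0ℚ ∷ p *ₚ r)    ≈⟨ +ₚ-congˡ {a ·ₚ r} (∷-cong ≡.refl (*ₚ-comm p r)) ⟩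
    a ·ₚ r +ₚ (0ℚ ∷ r *ₚ p)    ≈⟨ *ₚ-∷ r a p ⟨
    r *ₚ (a ∷ p)               ∎

  *ₚ-congˡ : ∀ p → r ≈ₚ r′ → p *ₚ r ≈ₚ p *ₚ r′
  *ₚ-congˡ []      r≈r′ = ≈ₚ-refl
  *ₚ-congˡ (a ∷ p) r≈r′ = +ₚ-cong (·ₚ-congˡ a r≈r′) (∷-cong ≡.refl (*ₚ-congˡ p r≈r′))

  *ₚ-cong : p ≈ₚ p′ → r ≈ₚ r′ → p *ₚ r ≈ₚ p′ *ₚ r′
  *ₚ-cong {p} {p′} {r} {r′} p≈p′ r≈r′ = begin
    p *ₚ r      ≈⟨ *ₚ-congˡ p r≈r′ ⟩
    p *ₚ r′     ≈⟨ *ₚ-comm p r′ ⟩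
    r′ *ₚ p     ≈⟨ *ₚ-congˡ r′ p≈p′ ⟩
    r′ *ₚ p′    ≈⟨ *ₚ-comm r′ p′ ⟩
    p′ *ₚ r′    ∎

  *ₚ-distribʳ : ∀ s p r → (p +ₚ r) *ₚ s ≈ₚ p *ₚ s +ₚ r *ₚ s
  *ₚ-distribʳ s []      r       = ≈ₚ-refl
  *ₚ-distribʳ s (a ∷ p) []      = ≈ₚ-sym (+ₚ-identityʳ ((a ∷ p) *ₚ s))
  *ₚ-distribʳ s (a ∷ p) (b ∷ r) = begin
    (a ℚ.+ b) ·ₚ s +ₚ (0ℚ ∷ (p +ₚ r) *ₚ s)
      ≈⟨ +ₚ-cong (·ₚ-distribʳ a b s) (∷-cong ≡.refl (*ₚ-distribʳ s p r)) ⟩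
    (a ·ₚ s +ₚ b ·ₚ s) +ₚ ((0ℚ ∷ p *ₚ s) +ₚ (0ℚ ∷ r *ₚ s))
      ≈⟨ +ₚ-interchange (a ·ₚ s) (b ·ₚ s) (0ℚ ∷ p *ₚ s) (0ℚ ∷ r *ₚ s) ⟩
    (a ∷ p) *ₚ s +ₚ (b ∷ r) *ₚ s
      ∎

  ·ₚ-*ₚ-assoc : ∀ a r s → (a ·ₚ r) *ₚ s ≈ₚ a ·ₚ (r *ₚ s)
  ·ₚ-*ₚ-assoc a []      s = ≈ₚ-refl
  ·ₚ-*ₚ-assoc a (b ∷ r) s = begin
    (a ℚ.* b) ·ₚ s +ₚ (0ℚ ∷ (a ·ₚ r) *ₚ s)
      ≈⟨ +ₚ-cong (·ₚ-assoc a b s) (∷-cong (≡.sym (ℚ.*-zeroʳ a)) (·ₚ-*ₚ-assoc a r s)) ⟩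
    a ·ₚ (b ·ₚ s) +ₚ a ·ₚ (0ℚ ∷ r *ₚ s)
      ≈⟨ ·ₚ-distribˡ a (b ·ₚ s) (0ℚ ∷ r *ₚ s) ⟨
    a ·ₚ ((b ∷ r) *ₚ s)
      ∎

  *ₚ-assoc : ∀ p r s → (p *ₚ r) *ₚ s ≈ₚ p *ₚ (r *ₚ s)
  *ₚ-assoc []      r s = ≈ₚ-refl
  *ₚ-assoc (a ∷ p) r s = begin
    (a ·ₚ r +ₚ (0ℚ ∷ p *ₚ r)) *ₚ s
      ≈⟨ *ₚ-distribʳ s (a ·ₚ r) (0ℚ ∷ p *ₚ r) ⟩
    (a ·ₚ r) *ₚ s +ₚ (0ℚ ∷ p *ₚ r) *ₚ s
      ≈⟨ +ₚ-cong (·ₚ-*ₚ-assoc a r s) (0∷-*ₚ ≡.refl (p *ₚ r) s) ⟩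
    a ·ₚ (r *ₚ s) +ₚ (0ℚ ∷ (p *ₚ r) *ₚ s)
      ≈⟨ +ₚ-congˡ {a ·ₚ (r *ₚ s)} (∷-cong ≡.refl (*ₚ-assoc p r s)) ⟩
    (a ∷ p) *ₚ (r *ₚ s)
      ∎

  *ₚ-identityˡ : ∀ p → 1ₚ *ₚ p ≈ₚ p
  *ₚ-identityˡ p = begin
    1ℚ ·ₚ p +ₚ (0ℚ ∷ [])    ≈⟨ +ₚ-cong (·ₚ-identity p) (∷-≈0 ≡.refl ≈ₚ-refl) ⟩
    p +ₚ 0ₚ                 ≈⟨ +ₚ-identityʳ p ⟩
    p                       ∎

polynomialRing : CommutativeRing 0ℓ 0ℓ
polynomialRing = record
  { isCommutativeRing = record
    { isRing = record
      { +-isAbelianGroup = AbelianGroup.isAbelianGroup +ₚ-0ₚ-abelianGroup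
      ; *-cong = *ₚ-cong
      ; *-assoc = *ₚ-assoc
      ; *-identity = comm∧idˡ⇒id *ₚ-comm {1ₚ} *ₚ-identityˡ
      ; distrib = comm∧distrʳ⇒distr +ₚ-cong *ₚ-comm *ₚ-distribʳ
      }
    ; *-comm = *ₚ-comm
    }
  }
  where open Consequences ≈ₚ-setoid

module ℚ[q] where
  open CommutativeRing polynomialRing public
  open RingProperties ring public using (-‿distribˡ-*)
  open CommutativeSemigroupProperties *-commutativeSemigroup public
    using (interchange; xy∙z≈xz∙y)

*ₚ-almostCancelʳ : AlmostRightCancellative _≈ₚ_ 0ₚ _*ₚ_
*ₚ-almostCancelʳ = noZeroDivisors⇒almostCancelʳ ℚ[q].ring *ₚ-domain

-- The field of rational functions

module _ where
  open SetoidReasoning ≈ₚ-setoid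
  open SemiringSolver ℚ[q].commutativeSemiring

  componentwise : ∀ {x y} → num x ≈ₚ num y → den x ≈ₚ den y → x ≈ y
  componentwise num≈ den≈ = cross (*ₚ-cong num≈ (≈ₚ-sym den≈))

  num≈0⇒≈0 : ∀ {x} → num x ≈ₚ 0ₚ → x ≈ 0#
  num≈0⇒≈0 {x} num≈0 = cross (*ₚ-zeroˡ (num x) 1ₚ num≈0)

  ≈-refl : ∀ {x} → x ≈ x
  ≈-refl = componentwise ≈ₚ-refl ≈ₚ-refl

  ≈-sym : ∀ {x y} → x ≈ y → y ≈ x
  ≈-sym (cross eq) = cross (≈ₚ-sym eq)

  ≈-trans : ∀ {x y z} → x ≈ y → y ≈ z → x ≈ z
  ≈-trans {x} {y} {z} (cross x≈y) (cross y≈z) = cross (*ₚ-almostCancelʳ (den y) _ _ (den≉0 y) (begin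
    (num x *ₚ den z) *ₚ den y    ≈⟨ ℚ[q].xy∙z≈xz∙y (num x) (den z) (den y) ⟩
    (num x *ₚ den y) *ₚ den z    ≈⟨ ℚ[q].*-congʳ x≈y ⟩
    (num y *ₚ den x) *ₚ den z    ≈⟨ ℚ[q].xy∙z≈xz∙y (num y) (den x) (den z) ⟩
    (num y *ₚ den z) *ₚ den x    ≈⟨ ℚ[q].*-congʳ y≈z ⟩
    (num z *ₚ den y) *ₚ den x    ≈⟨ ℚ[q].xy∙z≈xz∙y (num z) (den y) (den x) ⟩
    (num z *ₚ den x) *ₚ den y    ∎))

  +-cong : ∀ {x x′ y y′} → x ≈ x′ → y ≈ y′ → x + y ≈ x′ + y′
  +-cong {x} {x′} {y} {y′} (cross x≈x′) (cross y≈y′) = cross (begin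
    (num x *ₚ den y +ₚ num y *ₚ den x) *ₚ (den x′ *ₚ den y′)
      ≈⟨ collect (num x) (den x) (num y) (den y) (den x′) (den y′) ⟩
    (num x *ₚ den x′) *ₚ (den y *ₚ den y′) +ₚ (num y *ₚ den y′) *ₚ (den x *ₚ den x′)
      ≈⟨ +ₚ-cong (*ₚ-cong x≈x′ (*ₚ-comm (den y) (den y′))) (*ₚ-cong y≈y′ (*ₚ-comm (den x) (den x′))) ⟩
    (num x′ *ₚ den x) *ₚ (den y′ *ₚ den y) +ₚ (num y′ *ₚ den y) *ₚ (den x′ *ₚ den x)
      ≈⟨ collect (num x′) (den x′) (num y′) (den y′) (den x) (den y) ⟨
    (num x′ *ₚ den y′ +ₚ num y′ *ₚ den x′) *ₚ (den x *ₚ den y)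
      ∎)
    where
    collect : ∀ m b n d b′ d′ →
      (m *ₚ d +ₚ n *ₚ b) *ₚ (b′ *ₚ d′) ≈ₚ (m *ₚ b′) *ₚ (d *ₚ d′) +ₚ (n *ₚ d′) *ₚ (b *ₚ b′)
    collect = solve 6 (λ m b n d b′ d′ →
      (m :* d :+ n :* b) :* (b′ :* d′) := (m :* b′) :* (d :* d′) :+ (n :* d′) :* (b :* b′)) ≈ₚ-refl

  *-cong : ∀ {x x′ y y′} → x ≈ x′ → y ≈ y′ → x * y ≈ x′ * y′
  *-cong {x} {x′} {y} {y′} (cross x≈x′) (cross y≈y′) = cross (begin
    (num x *ₚ num y) *ₚ (den x′ *ₚ den y′)    ≈⟨ ℚ[q].interchange (num x) (num y) (den x′) (den y′) ⟩
    (num x *ₚ den x′) *ₚ (num y *ₚ den y′)    ≈⟨ *ₚ-cong x≈x′ y≈y′ ⟩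
    (num x′ *ₚ den x) *ₚ (num y′ *ₚ den y)    ≈⟨ ℚ[q].interchange (num x′) (den x) (num y′) (den y) ⟩
    (num x′ *ₚ num y′) *ₚ (den x *ₚ den y)    ∎)

  -‿cong : ∀ {x y} → x ≈ y → - x ≈ - y
  -‿cong {x} {y} (cross x≈y) = cross (begin
    (-ₚ num x) *ₚ den y    ≈⟨ ℚ[q].-‿distribˡ-* (num x) (den y) ⟨
    -ₚ (num x *ₚ den y)    ≈⟨ -ₚ-cong x≈y ⟩
    -ₚ (num y *ₚ den x)    ≈⟨ ℚ[q].-‿distribˡ-* (num y) (den x) ⟩
    (-ₚ num y) *ₚ den x    ∎)

  +-assoc : ∀ x y z → (x + y) + z ≈ x + (y + z)
  +-assoc x y z = componentwise
    (solve 6 (λ a b c d e f → (a :* d :+ c :* b) :* f :+ e :* (b :* d)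
                           := a :* (d :* f) :+ (c :* f :+ e :* d) :* b)
      ≈ₚ-refl (num x) (den x) (num y) (den y) (num z) (den z))
    (*ₚ-assoc (den x) (den y) (den z))

  +-comm : ∀ x y → x + y ≈ y + x
  +-comm x y = componentwise (+ₚ-comm (num x *ₚ den y) (num y *ₚ den x)) (*ₚ-comm (den x) (den y))

  +-identityʳ : ∀ x → x + 0# ≈ x
  +-identityʳ x = componentwise
    (≈ₚ-trans (+ₚ-identityʳ (num x *ₚ 1ₚ)) (ℚ[q].*-identityʳ (num x))) (ℚ[q].*-identityʳ (den x))

  -‿inverseʳ : ∀ x → x - x ≈ 0#
  -‿inverseʳ x = num≈0⇒≈0 (begin
    num x *ₚ den x +ₚ (-ₚ num x) *ₚ den x    ≈⟨ *ₚ-distribʳ (den x) (num x) (-ₚ num x) ⟨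
    (num x +ₚ (-ₚ num x)) *ₚ den x           ≈⟨ *ₚ-zeroˡ _ (den x) (-ₚ-inverseʳ (num x)) ⟩
    0ₚ                                       ∎)

  *-assoc : ∀ x y z → (x * y) * z ≈ x * (y * z)
  *-assoc x y z = componentwise (*ₚ-assoc (num x) (num y) (num z)) (*ₚ-assoc (den x) (den y) (den z))

  *-comm : ∀ x y → x * y ≈ y * x
  *-comm x y = componentwise (*ₚ-comm (num x) (num y)) (*ₚ-comm (den x) (den y))

  *-identityʳ : ∀ x → x * 1# ≈ x
  *-identityʳ x = componentwise (ℚ[q].*-identityʳ (num x)) (ℚ[q].*-identityʳ (den x))

  *-distribʳ : ∀ z x y → (x + y) * z ≈ x * z + y * z
  *-distribʳ z x y = cross (solve 6
    (λ a b c d e f → ((a :* d :+ c :* b) :* e) :* ((b :* f) :* (d :* f))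
                  := ((a :* e) :* (d :* f) :+ (c :* e) :* (b :* f)) :* ((b :* d) :* f))
    ≈ₚ-refl (num x) (den x) (num y) (den y) (num z) (den z))

  *-cancelʳ : ∀ {x y} z .{{_ : NonZero z}} → x * z ≈ y * z → x ≈ y
  *-cancelʳ {x} {y} z {{z≉0}} (cross xz≈yz) = cross (*ₚ-almostCancelʳ (num z *ₚ den z) _ _
    (λ eq → ⊥-elim-irr (*ₚ-≉0 (num≉0 z z≉0) (den≉0 z) eq)) (begin
    (num x *ₚ den y) *ₚ (num z *ₚ den z)    ≈⟨ ℚ[q].interchange (num x) (den y) (num z) (den z) ⟩
    (num x *ₚ num z) *ₚ (den y *ₚ den z)    ≈⟨ xz≈yz ⟩
    (num y *ₚ num z) *ₚ (den x *ₚ den z)    ≈⟨ ℚ[q].interchange (num y) (num z) (den x) (den z) ⟩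
    (num y *ₚ den x) *ₚ (num z *ₚ den z)    ∎))

  *-cancelˡ : ∀ x {y z} .{{_ : NonZero x}} → x * y ≈ x * z → y ≈ z
  *-cancelˡ x {y} {z} xy≈xz =
    *-cancelʳ x (≈-trans (*-comm y x) (≈-trans xy≈xz (*-comm x z)))

  x÷y*y≈x : ∀ x y .{{_ : NonZero y}} → (x ÷ y) * y ≈ x
  x÷y*y≈x x y = cross (solve 4 (λ a b c d → ((a :* d) :* c) :* b := a :* ((b :* c) :* d))
    ≈ₚ-refl (num x) (den x) (num y) (den y))

≈-setoid : Setoid 0ℓ 0ℓ
≈-setoid = record
  { _≈_ = _≈_
  ; isEquivalence = record { refl = ≈-refl ; sym = ≈-sym ; trans = ≈-trans }
  }

rationalFunctionRing : CommutativeRing 0ℓ 0ℓ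
rationalFunctionRing = record
  { Carrier = ℚ⟨q⟩ ; _≈_ = _≈_ ; _+_ = _+_ ; _*_ = _*_ ; -_ = -_ ; 0# = 0# ; 1# = 1#
  ; isCommutativeRing = record
    { isRing = record
      { +-isAbelianGroup = record
        { isGroup = record
          { isMonoid = record
            { isSemigroup = record
              { isMagma = record { isEquivalence = Setoid.isEquivalence ≈-setoid ; ∙-cong = +-cong }
              ; assoc = +-assoc
              }
            ; identity = comm∧idʳ⇒id +-comm +-identityʳ
            }
          ; inverse = comm∧invʳ⇒inv +-comm -‿inverseʳ
          ; ⁻¹-cong = -‿cong
          }
        ; comm = +-comm
        }
      ; *-cong = *-cong
      ; *-assoc = *-assoc
      ; *-identity = comm∧idʳ⇒id *-comm *-identityʳ
      ; distrib = comm∧distrʳ⇒distr +-cong *-comm *-distribʳ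
      }
    ; *-comm = *-comm
    }
  }
  where open Consequences ≈-setoid

module ℚ⟨q⟩-Ring = CommutativeRing rationalFunctionRing
open ℚ⟨q⟩-Ring using
  ( reflexive; semiring; commutativeSemiring; +-monoid; *-monoid; *-commutativeSemigroup
  ; +-congˡ; +-congʳ; *-congˡ; *-congʳ; *-identityˡ; distribˡ
  )
open RingProperties ℚ⟨q⟩-Ring.ring using (-‿distribˡ-*) renaming (//-cong₂ to -‿cong₂)
open CommutativeSemigroupProperties *-commutativeSemigroup
open Exp semiring using (^-homo-*; ^-assocʳ)
open MonoidMult +-monoid using (×-congʳ)
open SemiringSum semiring using (sum-cong-≋; *-distribˡ-sum; ∑-distrib-+)
open SetoidReasoning ≈-setoid

constant : ℚ → ℚ⟨q⟩
constant a = fromPoly (a ∷ [])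

constant-homomorphism : ℚ.+-*-rawRing -Raw-AlmostCommutative⟶ fromCommutativeRing rationalFunctionRing
constant-homomorphism = record
  { ⟦_⟧    = constant
  ; +-homo = λ a b → componentwise
      (≈ₚ-sym (+ₚ-cong (ℚ[q].*-identityʳ (a ∷ [])) (ℚ[q].*-identityʳ (b ∷ []))))
      (≈ₚ-sym (*ₚ-identityˡ 1ₚ))
  ; *-homo = λ a b → componentwise
      (∷-cong (≡.sym (ℚ.+-identityʳ (a ℚ.* b))) (≈ₚ-refl {[]}))
      (≈ₚ-sym (*ₚ-identityˡ 1ₚ))
  ; -‿homo = λ a → componentwise ≈ₚ-refl ≈ₚ-refl
  ; 0-homo = num≈0⇒≈0 (∷-≈0 ≡.refl ≈ₚ-refl)
  ; 1-homo = ≈-refl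
  }

constant-≟ : ∀ a b → Maybe (constant a ≈ constant b)
constant-≟ a b = Maybe.map (reflexive ∘ cong constant) (dec⇒weaklyDec ℚ._≟_ a b)

module ℚ⟨q⟩-Solver = RingSolver ℚ.+-*-rawRing (fromCommutativeRing rationalFunctionRing)
  constant-homomorphism constant-≟

[x÷[y÷z]]*y≈x*z : ∀ x y z .{{_ : NonZero z}} .{{_ : NonZero (y ÷ z)}} → (x ÷ (y ÷ z)) * y ≈ x * z
[x÷[y÷z]]*y≈x*z x y z = begin
  (x ÷ (y ÷ z)) * y                ≈⟨ *-congˡ (x÷y*y≈x y z) ⟨
  (x ÷ (y ÷ z)) * ((y ÷ z) * z)    ≈⟨ *-assoc (x ÷ (y ÷ z)) (y ÷ z) z ⟨
  ((x ÷ (y ÷ z)) * (y ÷ z)) * z    ≈⟨ *-congʳ (x÷y*y≈x x (y ÷ z)) ⟩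
  x * z                            ∎

[x÷y]*[zy÷xw]*w≈z : ∀ x y z w .{{_ : NonZero x}} .{{_ : NonZero y}} .{{_ : NonZero (x * w)}} →
  ((x ÷ y) * ((z * y) ÷ (x * w))) * w ≈ z
[x÷y]*[zy÷xw]*w≈z x y z w = *-cancelʳ x (begin
  (((x ÷ y) * t) * w) * x    ≈⟨ xy∙z≈x∙zy ((x ÷ y) * t) w x ⟩
  ((x ÷ y) * t) * (x * w)    ≈⟨ *-assoc (x ÷ y) t (x * w) ⟩
  (x ÷ y) * (t * (x * w))    ≈⟨ *-congˡ (x÷y*y≈x (z * y) (x * w)) ⟩
  (x ÷ y) * (z * y)          ≈⟨ x∙yz≈y∙xz (x ÷ y) z y ⟩
  z * ((x ÷ y) * y)          ≈⟨ *-congˡ (x÷y*y≈x x y) ⟩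
  z * x                      ∎)
  where
  t : ℚ⟨q⟩
  t = (z * y) ÷ (x * w)

-- With s = x / y and s′ = xu / yv this reads v s′ = u s.
scaledQuotient : ∀ {x y u v s s′} .{{_ : NonZero y}} →
  s * y ≈ x → s′ * (y * v) ≈ x * u → v * s′ ≈ u * s
scaledQuotient {x} {y} {u} {v} {s} {s′} sy≈x s′yv≈xu = *-cancelʳ y (begin
  (v * s′) * y    ≈⟨ xy∙z≈y∙zx v s′ y ⟩
  s′ * (y * v)    ≈⟨ s′yv≈xu ⟩
  x * u           ≈⟨ *-congʳ sy≈x ⟨
  (s * y) * u     ≈⟨ xy∙z≈zx∙y s y u ⟩
  (u * s) * y     ∎)

-- Powers

[x^m]^n≈[x^n]^m : ∀ x m n → (x ^ m) ^ n ≈ (x ^ n) ^ m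
[x^m]^n≈[x^n]^m x m n = begin
  (x ^ m) ^ n      ≈⟨ ^-assocʳ x m n ⟩
  x ^ (m ℕ.* n)    ≡⟨ cong (x ^_) (ℕ.*-comm m n) ⟩
  x ^ (n ℕ.* m)    ≈⟨ ^-assocʳ x n m ⟨
  (x ^ n) ^ m      ∎

x^[n∸m]*x^m≈x^n : ∀ x {m n} → m ℕ.≤ n → x ^ (n ℕ.∸ m) * x ^ m ≈ x ^ n
x^[n∸m]*x^m≈x^n x {m} {n} m≤n = begin
  x ^ (n ℕ.∸ m) * x ^ m    ≈⟨ ^-homo-* x (n ℕ.∸ m) m ⟨
  x ^ (n ℕ.∸ m ℕ.+ m)      ≡⟨ cong (x ^_) (ℕ.m∸n+n≡m m≤n) ⟩
  x ^ n                    ∎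

module _ {x : ℚ⟨q⟩} .{{x≉0 : NonZero x}} where

  ^ᶻ-⊖ : ∀ m n → x ^ᶻ (m ℤ.⊖ n) * x ^ n ≈ x ^ m
  ^ᶻ-⊖ m       zero    = *-identityʳ (x ^ m)
  ^ᶻ-⊖ zero    (suc n) = x÷y*y≈x 1# (x ^ suc n) {{^-nonZero x≉0 (suc n)}}
  ^ᶻ-⊖ (suc m) (suc n) = begin
    x ^ᶻ (suc m ℤ.⊖ suc n) * x ^ suc n    ≡⟨ cong (λ i → x ^ᶻ i * x ^ suc n) (ℤ.[1+m]⊖[1+n]≡m⊖n m n) ⟩
    x ^ᶻ (m ℤ.⊖ n) * (x * x ^ n)          ≈⟨ x∙yz≈y∙xz (x ^ᶻ (m ℤ.⊖ n)) x (x ^ n) ⟩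
    x * (x ^ᶻ (m ℤ.⊖ n) * x ^ n)          ≈⟨ *-congˡ (^ᶻ-⊖ m n) ⟩
    x * x ^ m                             ∎

  ^ᶻ-homo-*-pos : ∀ m i → x ^ᶻ (+ m ℤ.+ i) ≈ x ^ m * x ^ᶻ i
  ^ᶻ-homo-*-pos m (+ n)    = ^-homo-* x m n
  ^ᶻ-homo-*-pos m -[1+ n ] = *-cancelʳ (x ^ suc n) {{^-nonZero x≉0 (suc n)}} (begin
    x ^ᶻ (m ℤ.⊖ suc n) * x ^ suc n         ≈⟨ ^ᶻ-⊖ m (suc n) ⟩
    x ^ m                                  ≈⟨ *-identityʳ (x ^ m) ⟨
    x ^ m * 1#                             ≈⟨ *-congˡ (^ᶻ-⊖ 0 (suc n)) ⟨
    x ^ m * (x ^ᶻ -[1+ n ] * x ^ suc n)    ≈⟨ *-assoc (x ^ m) (x ^ᶻ -[1+ n ]) (x ^ suc n) ⟨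
    (x ^ m * x ^ᶻ -[1+ n ]) * x ^ suc n    ∎)

  ^ᶻ-homo-* : ∀ i j → x ^ᶻ (i ℤ.+ j) ≈ x ^ᶻ i * x ^ᶻ j
  ^ᶻ-homo-* (+ m)    j = ^ᶻ-homo-*-pos m j
  ^ᶻ-homo-* -[1+ m ] j = *-cancelˡ (x ^ suc m) {{^-nonZero x≉0 (suc m)}} (begin
    x ^ suc m * x ^ᶻ (-[1+ m ] ℤ.+ j)         ≈⟨ ^ᶻ-homo-*-pos (suc m) (-[1+ m ] ℤ.+ j) ⟨
    x ^ᶻ (+ suc m ℤ.+ (-[1+ m ] ℤ.+ j))       ≡⟨ cong (x ^ᶻ_) (ℤ.+-assoc (+ suc m) -[1+ m ] j) ⟨
    x ^ᶻ (+ suc m ℤ.+ -[1+ m ] ℤ.+ j)         ≡⟨ cong (λ i → x ^ᶻ (i ℤ.+ j)) (ℤ.+-inverseʳ (+ suc m)) ⟩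
    x ^ᶻ (ℤ.0ℤ ℤ.+ j)                         ≡⟨ cong (x ^ᶻ_) (ℤ.+-identityˡ j) ⟩
    x ^ᶻ j                                    ≈⟨ *-identityˡ (x ^ᶻ j) ⟨
    1# * x ^ᶻ j                               ≈⟨ *-congʳ (^ᶻ-⊖ 0 (suc m)) ⟨
    (x ^ᶻ -[1+ m ] * x ^ suc m) * x ^ᶻ j      ≈⟨ xy∙z≈y∙xz (x ^ᶻ -[1+ m ]) (x ^ suc m) (x ^ᶻ j) ⟩
    x ^ suc m * (x ^ᶻ -[1+ m ] * x ^ᶻ j)      ∎)

  ^ᶻ-pos-* : ∀ m n → x ^ᶻ (+ m ℤ.* + n) ≈ (x ^ n) ^ m
  ^ᶻ-pos-* m n = begin
    x ^ᶻ (+ m ℤ.* + n)    ≡⟨ cong (x ^ᶻ_) (ℤ.pos-* m n) ⟨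
    x ^ (m ℕ.* n)         ≈⟨ ^-assocʳ x m n ⟨
    (x ^ m) ^ n           ≈⟨ [x^m]^n≈[x^n]^m x m n ⟩
    (x ^ n) ^ m           ∎

  ^ᶻ-[i*d+j]/d : ∀ i j d .{{_ : ℕ.NonZero d}} →
    x ^ᶻ ((i ℤ.* + d ℤ.+ j) ℤ./ + d) ≈ x ^ᶻ i * x ^ᶻ (j ℤ./ + d)
  ^ᶻ-[i*d+j]/d i j d = begin
    x ^ᶻ ((i ℤ.* + d ℤ.+ j) ℤ./ + d)    ≡⟨ cong (x ^ᶻ_) ([i*d+j]/d≡i+j/d i j d) ⟩
    x ^ᶻ (i ℤ.+ j ℤ./ + d)              ≈⟨ ^ᶻ-homo-* i (j ℤ./ + d) ⟩
    x ^ᶻ i * x ^ᶻ (j ℤ./ + d)           ∎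

-- Sums, Pochhammer symbols and the coefficients C

∑-cong : ∀ n {f g : ℕ → ℚ⟨q⟩} → (∀ k → k ℕ.< n → f k ≈ g k) → ∑< n f ≈ ∑< n g
∑-cong n f≈g = sum-cong-≋ {n} λ k → f≈g (toℕ k) (Fin.toℕ<n k)

⨾-suc : ∀ a b n → ⟨ a ⨾ b ⟩ (suc n) ≈ ⟨ a ⨾ b ⟩ n * (1# - a * b ^ n)
⨾-suc a b = sum-toℕ-last *-monoid (λ j → 1# - a * b ^ j)

q^-[_choose2] : ℕ → ℚ⟨q⟩
q^-[ k choose2] = q ^ᶻ (ℤ.- (+ k ℤ.* (+ k ℤ.- + 1)) ℤ./ + 2)

-- Floor division commutes with adding multiples of 2, so the parity of n (n - 1) never matters.
q^-[choose2]-shift : ∀ {j} m n → j ≡ + m ℤ.* + 2 ℤ.- + n ℤ.* (+ n ℤ.- + 1) →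
  q ^ᶻ (j ℤ./ + 2) ≈ q ^ m * q^-[ n choose2]
q^-[choose2]-shift m n ≡.refl = ^ᶻ-[i*d+j]/d (+ m) (ℤ.- (+ n ℤ.* (+ n ℤ.- + 1))) 2

module _ (n : ℕ) where
  open ℤ-Solver

  q^-[choose2]-suc : q ^ n * q^-[ suc n choose2] ≈ q^-[ n choose2]
  q^-[choose2]-suc = ≈-sym (q^-[choose2]-shift n (suc n) (solve 1 (λ n →
    :- (n :* (n :- con (+ 1)))
    := n :* con (+ 2) :- (con (+ 1) :+ n) :* (con (+ 1) :+ n :- con (+ 1))) ≡.refl (+ n)))

  q^-[n+1][n-4]/2 :
    q ^ᶻ (ℤ.- ((+ n ℤ.+ + 1) ℤ.* (+ n ℤ.- + 4)) ℤ./ + 2) ≈ q ^ (2 ℕ.+ n) * q^-[ n choose2]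
  q^-[n+1][n-4]/2 = q^-[choose2]-shift (2 ℕ.+ n) n (solve 1 (λ n →
    :- ((n :+ con (+ 1)) :* (n :- con (+ 4)))
    := (con (+ 2) :+ n) :* con (+ 2) :- n :* (n :- con (+ 1))) ≡.refl (+ n))

  q^[2+3n-n²]/2 : q ^ᶻ ((+ 2 ℤ.+ + 3 ℤ.* + n ℤ.- + n ℤ.* + n) ℤ./ + 2) ≈ q ^ suc n * q^-[ n choose2]
  q^[2+3n-n²]/2 = q^-[choose2]-shift (suc n) n (solve 1 (λ n →
    con (+ 2) :+ con (+ 3) :* n :- n :* n
    := (con (+ 1) :+ n) :* con (+ 2) :- n :* (n :- con (+ 1))) ≡.refl (+ n))

  q^-[n+1][n-2]/2 : q ^ᶻ (ℤ.- ((+ n ℤ.+ + 1) ℤ.* (+ n ℤ.- + 2)) ℤ./ + 2) ≈ q ^ 1 * q^-[ n choose2]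
  q^-[n+1][n-2]/2 = q^-[choose2]-shift 1 n (solve 1 (λ n →
    :- ((n :+ con (+ 1)) :* (n :- con (+ 2)))
    := con (+ 1) :* con (+ 2) :- n :* (n :- con (+ 1))) ≡.refl (+ n))

  q^[n+1] : q ^ᶻ (+ n ℤ.+ + 1) ≈ q ^ suc n
  q^[n+1] = reflexive (cong (q ^_) (ℕ.+-comm n 1))

  q^m[n+1] : ∀ m → q ^ᶻ (+ m ℤ.* (+ n ℤ.+ + 1)) ≈ (q ^ suc n) ^ m
  q^m[n+1] m = ≈-trans (^ᶻ-pos-* m (n ℕ.+ 1)) (reflexive (cong (λ k → (q ^ k) ^ m) (ℕ.+-comm n 1)))

  2q^2[n+1] : 2 × q ^ᶻ (+ 2 ℤ.* (+ n ℤ.+ + 1)) ≈ (q ^ suc n) ^ 2 + (q ^ suc n) ^ 2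
  2q^2[n+1] = ≈-trans (×-congʳ 2 (q^m[n+1] 2)) (+-congˡ (+-identityʳ ((q ^ suc n) ^ 2)))

C-numerator : ∀ n → let qⁿ⁺¹ = q ^ suc n; P = q^-[ n choose2] in
  C n * (qⁿ⁺¹ - 1#) ≈ qⁿ⁺¹ + qⁿ⁺¹ ^ 3 + P + q * qⁿ⁺¹ * P - qⁿ⁺¹ * P - q ^ 1 * P - (qⁿ⁺¹ ^ 2 + qⁿ⁺¹ ^ 2)
C-numerator n = ≈-trans (x÷y*y≈x _ (q ^ suc n - 1#) {{q^[1+n]-1-nonZero n}})
  (q^[n+1] n ⟨ +-cong ⟩ q^m[n+1] n 3 ⟨ +-cong ⟩ ≈-refl ⟨ +-cong ⟩ q^-[n+1][n-4]/2 n
    ⟨ -‿cong₂ ⟩ q^[2+3n-n²]/2 n ⟨ -‿cong₂ ⟩ q^-[n+1][n-2]/2 n ⟨ -‿cong₂ ⟩ 2q^2[n+1] n)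

-C-closedForm : ∀ n → - C n ≈ q^-[ n choose2] * (1# - q) + q ^ suc n * (1# - q ^ suc n)
-C-closedForm n = *-cancelʳ (qⁿ⁺¹ - 1#) {{q^[1+n]-1-nonZero n}} (begin
  - C n * (qⁿ⁺¹ - 1#)
    ≈⟨ -‿distribˡ-* (C n) (qⁿ⁺¹ - 1#) ⟨
  - (C n * (qⁿ⁺¹ - 1#))
    ≈⟨ -‿cong (C-numerator n) ⟩
  - (qⁿ⁺¹ + qⁿ⁺¹ ^ 3 + P + q * qⁿ⁺¹ * P - qⁿ⁺¹ * P - q ^ 1 * P - (qⁿ⁺¹ ^ 2 + qⁿ⁺¹ ^ 2))
    ≈⟨ solve 3 (λ q Q P →
         :- (Q :+ Q :^ 3 :+ P :+ q :* Q :* P :- Q :* P :- q :^ 1 :* P :- (Q :^ 2 :+ Q :^ 2))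
         := (P :* (con 1ℚ :- q) :+ Q :* (con 1ℚ :- Q)) :* (Q :- con 1ℚ)) ≈-refl q qⁿ⁺¹ P ⟩
  (P * (1# - q) + qⁿ⁺¹ * (1# - qⁿ⁺¹)) * (qⁿ⁺¹ - 1#)
    ∎)
  where
  open ℚ⟨q⟩-Solver
  qⁿ⁺¹ P : ℚ⟨q⟩
  qⁿ⁺¹ = q ^ suc n
  P    = q^-[ n choose2]

-- The two sides of the identity

weightedReciprocal : ℕ → ℕ → ℚ⟨q⟩
weightedReciprocal n k = (q^-[ k choose2] ÷ qbinom n k) {{qbinom-nonZero n k}}

weightedReciprocal*⟨q⨾q⟩ : ∀ n k →
  weightedReciprocal n k * ⟨ q ⨾ q ⟩ n ≈ q^-[ k choose2] * (⟨ q ⨾ q ⟩ k * ⟨ q ⨾ q ⟩ (n ℕ.∸ k))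
weightedReciprocal*⟨q⨾q⟩ n k = [x÷[y÷z]]*y≈x*z
  q^-[ k choose2] (⟨ q ⨾ q ⟩ n) (⟨ q ⨾ q ⟩ k * ⟨ q ⨾ q ⟩ (n ℕ.∸ k))
  {{*-nonZero (⟨q⨾q⟩-nonZero k) (⟨q⨾q⟩-nonZero (n ℕ.∸ k))}} {{qbinom-nonZero n k}}

weightedReciprocal[n,0]≈1 : ∀ n → weightedReciprocal n 0 ≈ 1#
weightedReciprocal[n,0]≈1 n = *-cancelʳ F {{⟨q⨾q⟩-nonZero n}} (begin
  weightedReciprocal n 0 * F    ≈⟨ weightedReciprocal*⟨q⨾q⟩ n 0 ⟩
  1# * (1# * F)                 ≈⟨ *-congˡ (*-identityˡ F) ⟩
  1# * F                        ∎)
  where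
  F : ℚ⟨q⟩
  F = ⟨ q ⨾ q ⟩ n

weightedReciprocal[n,n]≈q^-[nchoose2] : ∀ n → weightedReciprocal n n ≈ q^-[ n choose2]
weightedReciprocal[n,n]≈q^-[nchoose2] n = *-cancelʳ (F n) {{⟨q⨾q⟩-nonZero n}} (begin
  weightedReciprocal n n * F n    ≈⟨ weightedReciprocal*⟨q⨾q⟩ n n ⟩
  P * (F n * F (n ℕ.∸ n))         ≡⟨ cong (λ m → P * (F n * F m)) (ℕ.n∸n≡0 n) ⟩
  P * (F n * 1#)                  ≈⟨ *-congˡ (*-identityʳ (F n)) ⟩
  P * F n                         ∎)
  where
  F : ℕ → ℚ⟨q⟩
  F = ⟨ q ⨾ q ⟩_
  P : ℚ⟨q⟩
  P = q^-[ n choose2]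

weightedReciprocal[1+n,k] : ∀ {n k} → k ℕ.≤ n →
  (1# - q ^ suc n) * weightedReciprocal (suc n) k ≈ (1# - q ^ suc (n ℕ.∸ k)) * weightedReciprocal n k
weightedReciprocal[1+n,k] {n} {k} k≤n =
  scaledQuotient {{⟨q⨾q⟩-nonZero n}} (weightedReciprocal*⟨q⨾q⟩ n k) (begin
    t * (F n * (1# - q ^ suc n))      ≈⟨ *-congˡ (⨾-suc q q n) ⟨
    t * F (suc n)                     ≈⟨ weightedReciprocal*⟨q⨾q⟩ (suc n) k ⟩
    P * (F k * F (suc n ℕ.∸ k))       ≡⟨ cong (λ m → P * (F k * F m)) (ℕ.+-∸-assoc 1 k≤n) ⟩
    P * (F k * F (suc (n ℕ.∸ k)))     ≈⟨ *-congˡ (*-congˡ (⨾-suc q q (n ℕ.∸ k))) ⟩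
    P * (F k * (F (n ℕ.∸ k) * u))     ≈⟨ *-congˡ (*-assoc (F k) (F (n ℕ.∸ k)) u) ⟨
    P * ((F k * F (n ℕ.∸ k)) * u)     ≈⟨ *-assoc P (F k * F (n ℕ.∸ k)) u ⟨
    (P * (F k * F (n ℕ.∸ k))) * u     ∎)
  where
  F : ℕ → ℚ⟨q⟩
  F = ⟨ q ⨾ q ⟩_
  t P u : ℚ⟨q⟩
  t = weightedReciprocal (suc n) k
  P = q^-[ k choose2]
  u = 1# - q ^ suc (n ℕ.∸ k)

weightedReciprocal[1+n,1+k] : ∀ n k →
  (1# - q ^ suc n) * (q ^ k * weightedReciprocal (suc n) (suc k))
    ≈ (1# - q ^ suc k) * weightedReciprocal n k
weightedReciprocal[1+n,1+k] n k =
  scaledQuotient {{⟨q⨾q⟩-nonZero n}} (weightedReciprocal*⟨q⨾q⟩ n k) (begin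
    (q ^ k * t) * (F n * (1# - q ^ suc n))    ≈⟨ *-congˡ (⨾-suc q q n) ⟨
    (q ^ k * t) * F (suc n)                   ≈⟨ *-assoc (q ^ k) t (F (suc n)) ⟩
    q ^ k * (t * F (suc n))                   ≈⟨ *-congˡ (weightedReciprocal*⟨q⨾q⟩ (suc n) (suc k)) ⟩
    q ^ k * (P′ * (F (suc k) * G))            ≈⟨ *-assoc (q ^ k) P′ (F (suc k) * G) ⟨
    (q ^ k * P′) * (F (suc k) * G)            ≈⟨ *-cong (q^-[choose2]-suc k) (*-congʳ (⨾-suc q q k)) ⟩
    P * ((F k * u) * G)                       ≈⟨ *-congˡ (xy∙z≈xz∙y (F k) u G) ⟩
    P * ((F k * G) * u)                       ≈⟨ *-assoc P (F k * G) u ⟨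
    (P * (F k * G)) * u                       ∎)
  where
  F : ℕ → ℚ⟨q⟩
  F = ⟨ q ⨾ q ⟩_
  t G P P′ u : ℚ⟨q⟩
  t  = weightedReciprocal (suc n) (suc k)
  G  = F (n ℕ.∸ k)
  P  = q^-[ k choose2]
  P′ = q^-[ suc k choose2]
  u  = 1# - q ^ suc k

weightedReciprocal-recurrence : ∀ {n k} → k ℕ.≤ n →
  (1# - q ^ suc n) * (weightedReciprocal (suc n) k + q ^ suc n * weightedReciprocal (suc n) (suc k))
    ≈ (1# - q ^ (2 ℕ.+ n)) * weightedReciprocal n k
weightedReciprocal-recurrence {n} {k} k≤n = begin
  (1# - qⁿ⁺¹) * (t₁₀ + qⁿ⁺¹ * t₁₁)
    ≈⟨ *-congˡ (+-congˡ (*-congʳ qⁿ⁺¹⁻ᵏ*qᵏ≈qⁿ⁺¹)) ⟨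
  (1# - qⁿ⁺¹) * (t₁₀ + (qⁿ⁺¹⁻ᵏ * qᵏ) * t₁₁)
    ≈⟨ solve 5 (λ Q x y t₁₀ t₁₁ → (con 1ℚ :- Q) :* (t₁₀ :+ (y :* x) :* t₁₁)
         := (con 1ℚ :- Q) :* t₁₀ :+ y :* ((con 1ℚ :- Q) :* (x :* t₁₁))) ≈-refl qⁿ⁺¹ qᵏ qⁿ⁺¹⁻ᵏ t₁₀ t₁₁ ⟩
  (1# - qⁿ⁺¹) * t₁₀ + qⁿ⁺¹⁻ᵏ * ((1# - qⁿ⁺¹) * (qᵏ * t₁₁))
    ≈⟨ +-cong (weightedReciprocal[1+n,k] k≤n) (*-congˡ (weightedReciprocal[1+n,1+k] n k)) ⟩
  (1# - qⁿ⁺¹⁻ᵏ) * t₀₀ + qⁿ⁺¹⁻ᵏ * ((1# - q * qᵏ) * t₀₀)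
    ≈⟨ solve 4 (λ q x y t₀₀ → (con 1ℚ :- y) :* t₀₀ :+ y :* ((con 1ℚ :- q :* x) :* t₀₀)
         := (con 1ℚ :- q :* (y :* x)) :* t₀₀) ≈-refl q qᵏ qⁿ⁺¹⁻ᵏ t₀₀ ⟩
  (1# - q * (qⁿ⁺¹⁻ᵏ * qᵏ)) * t₀₀
    ≈⟨ *-congʳ (+-congˡ (-‿cong (*-congˡ qⁿ⁺¹⁻ᵏ*qᵏ≈qⁿ⁺¹))) ⟩
  (1# - q * qⁿ⁺¹) * t₀₀
    ∎
  where
  open ℚ⟨q⟩-Solver
  qⁿ⁺¹ qᵏ qⁿ⁺¹⁻ᵏ t₀₀ t₁₀ t₁₁ : ℚ⟨q⟩
  qⁿ⁺¹   = q ^ suc n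
  qᵏ     = q ^ k
  qⁿ⁺¹⁻ᵏ = q ^ suc (n ℕ.∸ k)
  t₀₀    = weightedReciprocal n k
  t₁₀    = weightedReciprocal (suc n) k
  t₁₁    = weightedReciprocal (suc n) (suc k)
  qⁿ⁺¹⁻ᵏ*qᵏ≈qⁿ⁺¹ : qⁿ⁺¹⁻ᵏ * qᵏ ≈ qⁿ⁺¹
  qⁿ⁺¹⁻ᵏ*qᵏ≈qⁿ⁺¹ = ≈-trans (*-assoc q (q ^ (n ℕ.∸ k)) qᵏ) (*-congˡ (x^[n∸m]*x^m≈x^n q k≤n))

weightedReciprocalSum : ℕ → ℚ⟨q⟩
weightedReciprocalSum n = ∑[ k < n ] weightedReciprocal n k

weightedReciprocalSum-interior : ∀ n →
  (1# - q ^ suc n) * ((∑[ k < n ] weightedReciprocal (suc n) k)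
                      + q ^ suc n * (∑[ k < n ] weightedReciprocal (suc n) (suc k)))
    ≈ (1# - q ^ (2 ℕ.+ n)) * weightedReciprocalSum n
weightedReciprocalSum-interior n = begin
  (1# - qⁿ⁺¹) * ((∑[ k < n ] t k) + qⁿ⁺¹ * (∑[ k < n ] t (suc k)))
    ≈⟨ *-congˡ (+-congˡ (*-distribˡ-sum {n} qⁿ⁺¹ _)) ⟩
  (1# - qⁿ⁺¹) * ((∑[ k < n ] t k) + (∑[ k < n ] (qⁿ⁺¹ * t (suc k))))
    ≈⟨ *-congˡ (∑-distrib-+ {n} _ _) ⟨
  (1# - qⁿ⁺¹) * (∑[ k < n ] (t k + qⁿ⁺¹ * t (suc k)))
    ≈⟨ *-distribˡ-sum {n} (1# - qⁿ⁺¹) _ ⟩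
  (∑[ k < n ] ((1# - qⁿ⁺¹) * (t k + qⁿ⁺¹ * t (suc k))))
    ≈⟨ ∑-cong n (λ k k<n → weightedReciprocal-recurrence (ℕ.<⇒≤ k<n)) ⟩
  (∑[ k < n ] ((1# - q * qⁿ⁺¹) * weightedReciprocal n k))
    ≈⟨ *-distribˡ-sum {n} (1# - q * qⁿ⁺¹) _ ⟨
  (1# - q * qⁿ⁺¹) * weightedReciprocalSum n
    ∎
  where
  qⁿ⁺¹ : ℚ⟨q⟩
  qⁿ⁺¹ = q ^ suc n
  t : ℕ → ℚ⟨q⟩
  t = weightedReciprocal (suc n)

weightedReciprocalSum-boundary : ∀ n →
  (1# - q ^ suc n) * (weightedReciprocal (suc n) n + q ^ suc n * weightedReciprocal (suc n) 0) ≈ - C n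
weightedReciprocalSum-boundary n = begin
  (1# - qⁿ⁺¹) * (t n + qⁿ⁺¹ * t 0)
    ≈⟨ *-congˡ (+-congˡ (*-congˡ (weightedReciprocal[n,0]≈1 (suc n)))) ⟩
  (1# - qⁿ⁺¹) * (t n + qⁿ⁺¹ * 1#)
    ≈⟨ distribˡ (1# - qⁿ⁺¹) (t n) (qⁿ⁺¹ * 1#) ⟩
  (1# - qⁿ⁺¹) * t n + (1# - qⁿ⁺¹) * (qⁿ⁺¹ * 1#)
    ≈⟨ +-congʳ (weightedReciprocal[1+n,k] (ℕ.≤-refl {n})) ⟩
  (1# - q ^ suc (n ℕ.∸ n)) * weightedReciprocal n n + (1# - qⁿ⁺¹) * (qⁿ⁺¹ * 1#)
    ≈⟨ +-congʳ (*-cong (reflexive (cong (λ m → 1# - q ^ suc m) (ℕ.n∸n≡0 n)))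
                       (weightedReciprocal[n,n]≈q^-[nchoose2] n)) ⟩
  (1# - q ^ 1) * P + (1# - qⁿ⁺¹) * (qⁿ⁺¹ * 1#)
    ≈⟨ solve 3 (λ q Q P → (con 1ℚ :- q :^ 1) :* P :+ (con 1ℚ :- Q) :* (Q :* con 1ℚ)
         := P :* (con 1ℚ :- q) :+ Q :* (con 1ℚ :- Q)) ≈-refl q qⁿ⁺¹ P ⟩
  P * (1# - q) + qⁿ⁺¹ * (1# - qⁿ⁺¹)
    ≈⟨ -C-closedForm n ⟨
  - C n
    ∎
  where
  open ℚ⟨q⟩-Solver
  qⁿ⁺¹ P : ℚ⟨q⟩
  qⁿ⁺¹ = q ^ suc n
  P    = q^-[ n choose2]
  t : ℕ → ℚ⟨q⟩
  t = weightedReciprocal (suc n)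

weightedReciprocalSum-recurrence : ∀ n →
  (1# - (q ^ suc n) ^ 2) * weightedReciprocalSum (suc n)
    ≈ (1# - q ^ (2 ℕ.+ n)) * weightedReciprocalSum n - C n
weightedReciprocalSum-recurrence n = begin
  (1# - qⁿ⁺¹ ^ 2) * S
    ≈⟨ solve 2 (λ Q S → (con 1ℚ :- Q :^ 2) :* S := (con 1ℚ :- Q) :* (S :+ Q :* S)) ≈-refl qⁿ⁺¹ S ⟩
  (1# - qⁿ⁺¹) * (S + qⁿ⁺¹ * S)
    ≈⟨ *-congˡ (+-congʳ (sum-toℕ-last +-monoid t n)) ⟩
  (1# - qⁿ⁺¹) * ((∑< n t + t n) + qⁿ⁺¹ * (t 0 + ∑< n (t ∘ suc)))
    ≈⟨ solve 5 (λ Q A l B f → (con 1ℚ :- Q) :* ((A :+ l) :+ Q :* (f :+ B))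
         := (con 1ℚ :- Q) :* (A :+ Q :* B) :+ (con 1ℚ :- Q) :* (l :+ Q :* f))
         ≈-refl qⁿ⁺¹ (∑< n t) (t n) (∑< n (t ∘ suc)) (t 0) ⟩
  (1# - qⁿ⁺¹) * (∑< n t + qⁿ⁺¹ * ∑< n (t ∘ suc)) + (1# - qⁿ⁺¹) * (t n + qⁿ⁺¹ * t 0)
    ≈⟨ +-cong (weightedReciprocalSum-interior n) (weightedReciprocalSum-boundary n) ⟩
  (1# - q * qⁿ⁺¹) * weightedReciprocalSum n - C n
    ∎
  where
  open ℚ⟨q⟩-Solver
  qⁿ⁺¹ S : ℚ⟨q⟩
  qⁿ⁺¹ = q ^ suc n
  S    = weightedReciprocalSum (suc n)
  t : ℕ → ℚ⟨q⟩
  t = weightedReciprocal (suc n)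

pochhammerRatio : ℕ → ℚ⟨q⟩
pochhammerRatio n = (⟨ q ^ 2 ⨾ q ⟩ n ÷ ⟨ q ^ 2 ⨾ q ^ 2 ⟩ n) {{⟨q²⨾q²⟩-nonZero n}}

pochhammerRatio-recurrence : ∀ n →
  (1# - (q ^ suc n) ^ 2) * pochhammerRatio (suc n) ≈ (1# - q ^ (2 ℕ.+ n)) * pochhammerRatio n
pochhammerRatio-recurrence n =
  scaledQuotient {{⟨q²⨾q²⟩-nonZero n}} (x÷y*y≈x (H n) (E n) {{⟨q²⨾q²⟩-nonZero n}}) (begin
    pochhammerRatio (suc n) * (E n * (1# - (q ^ suc n) ^ 2))
      ≈⟨ *-congˡ (*-congˡ (+-congˡ (-‿cong ([x^m]^n≈[x^n]^m q 2 (suc n))))) ⟨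
    pochhammerRatio (suc n) * (E n * (1# - q ^ 2 * (q ^ 2) ^ n))
      ≈⟨ *-congˡ (⨾-suc (q ^ 2) (q ^ 2) n) ⟨
    pochhammerRatio (suc n) * E (suc n)
      ≈⟨ x÷y*y≈x (H (suc n)) (E (suc n)) {{⟨q²⨾q²⟩-nonZero (suc n)}} ⟩
    H (suc n)
      ≈⟨ ⨾-suc (q ^ 2) q n ⟩
    H n * (1# - q ^ 2 * q ^ n)
      ≈⟨ *-congˡ (+-congˡ (-‿cong (^-homo-* q 2 n))) ⟨
    H n * (1# - q ^ (2 ℕ.+ n))
      ∎)
  where
  H E : ℕ → ℚ⟨q⟩
  H = ⟨ q ^ 2 ⨾ q ⟩_
  E = ⟨ q ^ 2 ⨾ q ^ 2 ⟩_

closedFormTerm : ℕ → ℚ⟨q⟩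
closedFormTerm i = ((C i * ⟨ q ^ 2 ⨾ q ^ 2 ⟩ i) ÷ (⟨ q ^ 2 ⨾ q ⟩ i * (q ^ (2 ℕ.+ i) - 1#)))
  {{*-nonZero (⟨q²⨾q⟩-nonZero i) (q^[1+n]-1-nonZero (suc i))}}

pochhammerRatio*closedFormTerm : ∀ n →
  (1# - q ^ (2 ℕ.+ n)) * (pochhammerRatio n * closedFormTerm n) ≈ - C n
pochhammerRatio*closedFormTerm n = begin
  (1# - qⁿ⁺²) * s
    ≈⟨ solve 2 (λ Q s → (con 1ℚ :- Q) :* s := :- (s :* (Q :- con 1ℚ))) ≈-refl qⁿ⁺² s ⟩
  - (s * (qⁿ⁺² - 1#))
    ≈⟨ -‿cong ([x÷y]*[zy÷xw]*w≈z (⟨ q ^ 2 ⨾ q ⟩ n) (⟨ q ^ 2 ⨾ q ^ 2 ⟩ n) (C n) (qⁿ⁺² - 1#)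
         {{⟨q²⨾q⟩-nonZero n}} {{⟨q²⨾q²⟩-nonZero n}}
         {{*-nonZero (⟨q²⨾q⟩-nonZero n) (q^[1+n]-1-nonZero (suc n))}}) ⟩
  - C n
    ∎
  where
  open ℚ⟨q⟩-Solver
  qⁿ⁺² s : ℚ⟨q⟩
  qⁿ⁺² = q ^ (2 ℕ.+ n)
  s    = pochhammerRatio n * closedFormTerm n

1-[q^[1+n]]²-nonZero : ∀ n → NonZero (1# - (q ^ suc n) ^ 2)
1-[q^[1+n]]²-nonZero n = at0-nonZero (λ ()) (at0-+ at0-1 (at0-neg (at0-^ (at0-^ at0-q n) 1)))

theorem2 : (n : ℕ) → 1 ℕ.≤ n →
  (∑[ k < n ] ((q ^ᶻ (ℤ.- (+ k ℤ.* (+ k ℤ.- + 1)) ℤ./ + 2) ÷ qbinom n k) {{qbinom-nonZero n k}}))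
  ≈ (⟨ q ^ 2 ⨾ q ⟩ n ÷ ⟨ q ^ 2 ⨾ q ^ 2 ⟩ n) {{⟨q²⨾q²⟩-nonZero n}}
    * (∑[ i < n ] (((C i * ⟨ q ^ 2 ⨾ q ^ 2 ⟩ i) ÷ (⟨ q ^ 2 ⨾ q ⟩ i * (q ^ (2 ℕ.+ i) - 1#)))
                     {{*-nonZero (⟨q²⨾q⟩-nonZero i) (q^[1+n]-1-nonZero (suc i))}}))
theorem2 n _ = variationOfConstants commutativeSemiring
  {b = λ n → 1# - q ^ (2 ℕ.+ n)} {c = λ n → - C n} {w = closedFormTerm}
  (λ n → *-cancelˡ (1# - (q ^ suc n) ^ 2) {{1-[q^[1+n]]²-nonZero n}})
  pochhammerRatio-recurrence
  ≈-refl
  weightedReciprocalSum-recurrence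
  pochhammerRatio*closedFormTerm
  n
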